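{- Let $1\le i\le k$, $S=\{i,\ldots,k\}$, and let $\mathrm{Th}^i_k=f_{S,k}$ be the threshold function. Let $p^*\in[0,1]$ be such that $$\alpha(\mathrm{Th}^i_k)=\inf_{\mathcal D_N\in\Delta_k}\left(\frac{\lambda_S(\mathcal D_N,p^*)}{\gamma_{S,k}(\mu(\mathcal D_N))}\right).$$ Then the following randomized algorithm, on input an instance $\Psi$ of $\mathsf{Max\text{ - }CSP}(\mathrm{Th}^i_k)$, outputs an assignment whose expected value $\mathrm{val}_\Psi(\cdot)$ is at least $\alpha(\mathrm{Th}^i_k)\cdot\mathrm{val}_\Psi$: assign each variable $x_v$ to $1$ if $\mathrm{diff}_v(\Psi)\ge 0$ and to $-1$ otherwise, and then, independently for each variable, keep its assignment with probability $p^*$ and flip it with probability $1-p^*$.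
   Context: $\mathrm{Th}^i_k(\mathbf x)=1$ iff at least $i$ coordinates of $\mathbf x\in\{ -1,1\}^k$ equal $1$. **CSPs.** An $n$-variable instance $\Psi$ of $\mathsf{Max\text{ - }CSP}(f)$, $f:\{ -1,1\}^k\to\{0,1\}$, is a list of constraints $(\mathbf b(\ell),\mathbf j(\ell))$, $\ell\in[m]$, with non-negative weights $w_\ell$ and total weight $W=\sum_\ell w_\ell>0$, where $\mathbf j(\ell)\in[n]^k$ has distinct entries and $\mathbf b(\ell)\in\{ -1,1\}^k$. For $\boldsymbol\sigma\in\{ -1,1\}^n$, $\mathrm{val}_\Psi(\boldsymbol\sigma)=\frac1W\sum_\ell w_\ell f(\mathbf b(\ell)\odot\boldsymbol\sigma|_{\mathbf j(\ell)})$, with $\odot$ the coordinatewise product and $\boldsymbol\sigma|_{\mathbf j}=(\sigma_{j_1},\dots,\sigma_{j_k})$; $\mathrm{val}_\Psi=\max_{\boldsymbol\sigma}\mathrm{val}_\Psi(\boldsymbol\sigma)$. For $v\in[n]$, $\mathrm{diff}_v(\Psi)=\sum_{\ell,t:\ j(\ell)_t=v}b(\ell)_t\,w_\ell$. **Ratio $\alpha$.** $\Delta_k$ is the set of probability distributions on $\{ -1,1\}^k$ giving equal probability to vectors with the same number of $1$'s. $\mathrm{Bern}(p)$ is $1$ with probability $p$ and $-1$ with probability $1-p$. For $\mathcal D\in\Delta_k$: $\lambda_S(\mathcal D,p)=\mathbb E_{\mathbf a\sim\mathcal D,\mathbf b\sim\mathrm{Bern}(p)^k}[f_{S,k}(\mathbf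 a\odot\mathbf b)]$, $\mu(\mathcal D)=\mathbb E_{\mathbf b\sim\mathcal D}[b_1]$, $\beta_S(\mathcal D)=\sup_{p\in[0,1]}\lambda_S(\mathcal D,p)$, $\gamma_S(\mathcal D)=\lambda_S(\mathcal D,1)$; for $\mu\in[-1,1]$, $\gamma_{S,k}(\mu)=\sup\{\gamma_S(\mathcal D):\mathcal D\in\Delta_k,\ \mu(\mathcal D)=\mu\}$; and $\alpha(f_{S,k})=\inf\frac{\beta_S(\mathcal D_N)}{\gamma_S(\mathcal D_Y)}$ over $\mathcal D_N,\mathcal D_Y\in\Delta_k$ with $\mu(\mathcal D_N)=\mu(\mathcal D_Y)$. Ratios with zero denominator are taken to be $+\infty$. -}

module Defs where

open import Algebra.Bundles using (CommutativeRing)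
open import Algebra.Core using (Op₁; Op₂)
import Algebra.Properties.CommutativeMonoid.Sum as Summation
import Algebra.Properties.Ring as RingProperties
open import Algebra.Structures using (IsCommutativeRing)
open import Data.Bool.Base using (Bool; true; false; if_then_else_; T)
open import Data.Empty using (⊥; ⊥-elim)
open import Data.Fin.Base using (Fin; toℕ; fromℕ<)
import Data.Fin.Properties as Fin
open import Data.Fin.Subset using (Subset)
open import Data.Nat.Base as ℕ using (ℕ; zero; suc; s≤s)
import Data.Nat.Properties as ℕ
open import Data.Product.Base using (∃; ∃-syntax; Σ-syntax; _×_; _,_; proj₁; proj₂)
open import Data.Sign.Base as Sign using (Sign) renaming (+ to pos; - to neg)
import Data.Sign.Properties as Sign
open import Data.Sum.Base using (inj₁; inj₂)
open import Data.Unit.Base using (⊤; tt)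
open import Data.Vec.Base as Vec using (Vec; []; _∷_; lookup; tabulate; zipWith; count; replicate)
import Data.Vec.Properties as Vec
open import Data.Vec.Relation.Unary.Unique.Propositional using (Unique)
open import Function.Base using (_∘_; _$_)
open import Level using (0ℓ)
open import Relation.Binary.Core using (Rel)
open import Relation.Binary.Structures using (IsDecTotalOrder)
open import Relation.Binary.PropositionalEquality
open import Relation.Nullary using (yes; no; does)
open import Relation.Nullary.Decidable using (dec-false)

------------------------------------------------------------------------
-- The real numbers

-- The classical axioms of ℝ, which determine it up to isomorphism.
-- Classical logic enters only through the decidable order and the
-- existence of all least upper bounds.

record CompleteOrderedField : Set₁ where
  infixl 6 _+_
  infixl 7 _*_
  infix  8 -_
  infix  4 _≤_

  field
    Carrier           : Set
    _+_ _*_           : Op₂ Carrier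
    -_                : Op₁ Carrier
    0# 1#             : Carrier
    _≤_               : Rel Carrier 0ℓ
    isCommutativeRing : IsCommutativeRing _≡_ _+_ _*_ -_ 0# 1#
    0≢1               : 0# ≢ 1#
    inverse           : ∀ x → x ≢ 0# → ∃[ y ] x * y ≡ 1#
    isDecTotalOrder   : IsDecTotalOrder _≡_ _≤_
    +-monoˡ-≤         : ∀ z {x y} → x ≤ y → x + z ≤ y + z
    *-nonneg          : ∀ {x y} → 0# ≤ x → 0# ≤ y → 0# ≤ x * y

  UpperBound : (Carrier → Set) → Carrier → Set
  UpperBound P u = ∀ x → P x → x ≤ u

  IsSupremum : (Carrier → Set) → Carrier → Set
  IsSupremum P s = UpperBound P s × (∀ u → UpperBound P u → s ≤ u)

  field
    complete : (P : Carrier → Set) → ∃ P → ∃ (UpperBound P) → ∃ (IsSupremum P)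

  commutativeRing : CommutativeRing 0ℓ 0ℓ
  commutativeRing = record { isCommutativeRing = isCommutativeRing }

  open CommutativeRing commutativeRing public
    using (ring; +-commutativeMonoid; +-comm; +-assoc; *-comm; *-assoc;
           +-identityˡ; +-identityʳ; *-identityˡ; *-identityʳ;
           -‿inverseˡ; -‿inverseʳ; distribˡ; distribʳ; zeroˡ; zeroʳ; _-_)

  open IsDecTotalOrder isDecTotalOrder public
    using (_≤?_; _≟_)
    renaming (refl to ≤-refl; trans to ≤-trans; antisym to ≤-antisym;
              total to ≤-total; reflexive to ≤-reflexive)

  open Summation +-commutativeMonoid public using (sum)

  infix 4 _<_
  _<_ : Rel Carrier 0ℓ
  x < y = x ≤ y × x ≢ y

  infixl 6 _⊔_
  _⊔_ : Op₂ Carrier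
  x ⊔ y = if does (x ≤? y) then y else x

  divide : (x y : Carrier) → y ≢ 0# → Carrier
  divide x y y≢0 = x * proj₁ (inverse y y≢0)

  sup : (P : Carrier → Set) → ∃ P → ∃ (UpperBound P) → Carrier
  sup P nonempty bounded = proj₁ (complete P nonempty bounded)

  sup-isSupremum : ∀ P nonempty bounded → IsSupremum P (sup P nonempty bounded)
  sup-isSupremum P nonempty bounded = proj₂ (complete P nonempty bounded)

  ----------------------------------------------------------------------
  -- Elementary order facts

  +-mono-≤ : ∀ {x y u v} → x ≤ y → u ≤ v → x + u ≤ y + v
  +-mono-≤ {x} {y} {u} {v} x≤y u≤v = ≤-trans (+-monoˡ-≤ u x≤y)
    (subst₂ _≤_ (+-comm u y) (+-comm v y) (+-monoˡ-≤ y u≤v))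

  +-nonneg : ∀ {x y} → 0# ≤ x → 0# ≤ y → 0# ≤ x + y
  +-nonneg {x} {y} p q = subst (_≤ x + y) (+-identityˡ 0#) (+-mono-≤ p q)

  x≤y⇒0≤y-x : ∀ {x y} → x ≤ y → 0# ≤ y - x
  x≤y⇒0≤y-x {x} {y} p = subst (_≤ y - x) (-‿inverseʳ x) (+-monoˡ-≤ (- x) p)

  y-x+x≡y : ∀ x y → (y - x) + x ≡ y
  y-x+x≡y x y = trans (+-assoc y (- x) x)
    (trans (cong (y +_) (-‿inverseˡ x)) (+-identityʳ y))

  0≤y-x⇒x≤y : ∀ {x y} → 0# ≤ y - x → x ≤ y
  0≤y-x⇒x≤y {x} {y} p = subst₂ _≤_ (+-identityˡ x) (y-x+x≡y x y) (+-monoˡ-≤ x p)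

  *-monoʳ-≤ : ∀ {z x y} → 0# ≤ z → x ≤ y → z * x ≤ z * y
  *-monoʳ-≤ {z} {x} {y} 0≤z x≤y = 0≤y-x⇒x≤y $
    subst (0# ≤_)
      (trans (distribˡ z y (- x)) (cong (z * y +_) (sym (-‿distribʳ-* z x))))
      (*-nonneg 0≤z (x≤y⇒0≤y-x x≤y))
    where open RingProperties ring using (-‿distribʳ-*)

  x≤0⇒0≤-x : ∀ {x} → x ≤ 0# → 0# ≤ - x
  x≤0⇒0≤-x {x} p = subst (0# ≤_) (+-identityˡ (- x)) (x≤y⇒0≤y-x p)

  0≤1 : 0# ≤ 1#
  0≤1 with ≤-total 0# 1#
  ... | inj₁ p = p
  ... | inj₂ q = subst (0# ≤_)
      (trans (sym (-‿distribˡ-* 1# (- 1#)))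
        (trans (cong -_ (*-identityˡ (- 1#))) (-‿involutive 1#)))
      (*-nonneg (x≤0⇒0≤-x q) (x≤0⇒0≤-x q))
    where open RingProperties ring using (-‿distribˡ-*; -‿involutive)

  inverse-nonneg : ∀ {x} (x≢0 : x ≢ 0#) → 0# ≤ x → 0# ≤ proj₁ (inverse x x≢0)
  inverse-nonneg {x} x≢0 0≤x with inverse x x≢0
  ... | y , xy≡1 with ≤-total 0# y
  ...   | inj₁ 0≤y = 0≤y
  ...   | inj₂ y≤0 = ⊥-elim $ 0≢1 $ ≤-antisym 0≤1
    (subst₂ _≤_ xy≡1 (zeroʳ x) (*-monoʳ-≤ 0≤x y≤0))

  divide-nonneg : ∀ {x y} (y≢0 : y ≢ 0#) → 0# ≤ x → 0# ≤ y → 0# ≤ divide x y y≢0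
  divide-nonneg y≢0 0≤x 0≤y = *-nonneg 0≤x (inverse-nonneg y≢0 0≤y)

  ----------------------------------------------------------------------
  -- Ratios in ℝ ∪ {+∞} and infima of sets of such ratios

  data Extended : Set where
    fin : Carrier → Extended
    +∞  : Extended

  infix 4 _≤∞_
  _≤∞_ : Extended → Extended → Set
  fin x ≤∞ fin y = x ≤ y
  _     ≤∞ +∞    = ⊤
  +∞    ≤∞ fin _ = ⊥

  ratio : Carrier → Carrier → Extended
  ratio x y with y ≟ 0#
  ... | yes _  = +∞
  ... | no y≢0 = fin (divide x y y≢0)

  ratio-nonneg : ∀ {x y} → 0# ≤ x → 0# ≤ y → fin 0# ≤∞ ratio x y
  ratio-nonneg {x} {y} 0≤x 0≤y with y ≟ 0#
  ... | yes _  = tt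
  ... | no y≢0 = divide-nonneg y≢0 0≤x 0≤y

  ratio-finite : ∀ {x y} → y ≢ 0# → ∃[ q ] fin q ≡ ratio x y
  ratio-finite {x} {y} y≢0 with y ≟ 0#
  ... | yes y≡0 = ⊥-elim (y≢0 y≡0)
  ... | no _    = _ , refl

  LowerBound : (Extended → Set) → Carrier → Set
  LowerBound P l = ∀ r → P r → fin l ≤∞ r

  -- The greatest lower bound of P in ℝ ∪ {+∞}: it is a real number as
  -- soon as P has a finite member and is bounded below, and it is then
  -- the supremum of the real lower bounds.

  inf : (P : Extended → Set) → ∃[ x ] P (fin x) → ∃ (LowerBound P) → Carrier
  inf P (x , Px) bounded = sup (LowerBound P) bounded (x , λ l l≤P → l≤P (fin x) Px)

  inf-lower : ∀ P finite bounded → LowerBound P (inf P finite bounded)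
  inf-lower P finite bounded (fin x) Px =
    proj₂ (sup-isSupremum (LowerBound P) _ _) x (λ l l≤P → l≤P (fin x) Px)
  inf-lower P finite bounded +∞ _ = tt

  inf-greatest : ∀ P finite bounded l → LowerBound P l → l ≤ inf P finite bounded
  inf-greatest P finite bounded = proj₁ (sup-isSupremum (LowerBound P) _ _)

------------------------------------------------------------------------
-- Sign vectors and symmetric predicates

infixl 7 _⊙_
_⊙_ : ∀ {k} → Vec Sign k → Vec Sign k → Vec Sign k
_⊙_ = zipWith Sign._*_

ones : ∀ {k} → Vec Sign k → ℕ
ones = count (Sign._≟ pos)

ones≤k : ∀ {k} (x : Vec Sign k) → ones x ℕ.≤ k
ones≤k = Vec.count≤n (Sign._≟ pos)

-- f S is f_{S,k}, where S ⊆ {0,…,k}: it accepts the vectors whose number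
-- of 1s lies in S.

f : ∀ {k} → Subset (suc k) → Vec Sign k → Bool
f S x = lookup S (fromℕ< (s≤s (ones≤k x)))

Th : ∀ {k} → ℕ → Vec Sign k → Bool
Th i x = i ℕ.≤ᵇ ones x

-- {i,…,k} as a subset of {0,…,k}.

from : ∀ {k} → ℕ → Subset (suc k)
from i = tabulate (λ s → i ℕ.≤ᵇ toℕ s)

Th≗f : ∀ {k} i → Th {k} i ≗ f (from i)
Th≗f i x = sym (trans
  (Vec.lookup∘tabulate (λ s → i ℕ.≤ᵇ toℕ s) (fromℕ< (s≤s (ones≤k x))))
  (cong (i ℕ.≤ᵇ_) (Fin.toℕ-fromℕ< (s≤s (ones≤k x)))))

------------------------------------------------------------------------
-- Distributions, Max-CSP and the ratio α over a fixed copy of ℝ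

module MaxCSP {{ℝ : CompleteOrderedField}} where
  open CompleteOrderedField ℝ

  ⟦_⟧ : Bool → Carrier
  ⟦ b ⟧ = if b then 1# else 0#

  ⟦_⟧± : Sign → Carrier
  ⟦ pos ⟧± = 1#
  ⟦ neg ⟧± = - 1#

  -- Sum and maximum over all of {-1,1}ⁿ.

  ∑± : ∀ {n} → (Vec Sign n → Carrier) → Carrier
  ∑± {zero}  g = g []
  ∑± {suc n} g = ∑± (g ∘ (pos ∷_)) + ∑± (g ∘ (neg ∷_))

  max± : ∀ {n} → (Vec Sign n → Carrier) → Carrier
  max± {zero}  g = g []
  max± {suc n} g = max± (g ∘ (pos ∷_)) ⊔ max± (g ∘ (neg ∷_))

  -- Expectation of g under the distribution with mass function m.

  𝔼 : ∀ {n} → (Vec Sign n → Carrier) → (Vec Sign n → Carrier) → Carrier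
  𝔼 m g = ∑± (λ x → m x * g x)

  -- The mass function of Bern(p)ⁿ.

  Bern^ : ∀ {n} → Carrier → Vec Sign n → Carrier
  Bern^ p []        = 1#
  Bern^ p (pos ∷ b) = p * Bern^ p b
  Bern^ p (neg ∷ b) = (1# - p) * Bern^ p b

  record Δ (k : ℕ) : Set where
    field
      mass      : Vec Sign k → Carrier
      nonneg    : ∀ x → 0# ≤ mass x
      total     : ∑± mass ≡ 1#
      symmetric : ∀ x y → ones x ≡ ones y → mass x ≡ mass y

  open Δ public

  I01 : Carrier → Set
  I01 p = 0# ≤ p × p ≤ 1#

  λₛ : ∀ {k} → Subset (suc k) → Δ k → Carrier → Carrier
  λₛ S D p = 𝔼 (mass D) (λ a → 𝔼 (Bern^ p) (λ b → ⟦ f S (a ⊙ b) ⟧))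

  -- The expectation of the first coordinate, which exists since the
  -- arity suc k is positive.

  μ : ∀ {k} → Δ (suc k) → Carrier
  μ D = 𝔼 (mass D) (λ b → ⟦ Vec.head b ⟧±)

  ----------------------------------------------------------------------
  -- λₛ takes values in [0,1]

  ∑±-cong : ∀ {n} {g h : Vec Sign n → Carrier} → g ≗ h → ∑± g ≡ ∑± h
  ∑±-cong {zero}  e = e []
  ∑±-cong {suc n} e = cong₂ _+_ (∑±-cong (e ∘ (pos ∷_))) (∑±-cong (e ∘ (neg ∷_)))

  ∑±-mono : ∀ {n} {g h : Vec Sign n → Carrier} → (∀ x → g x ≤ h x) → ∑± g ≤ ∑± h
  ∑±-mono {zero}  e = e []
  ∑±-mono {suc n} e = +-mono-≤ (∑±-mono (e ∘ (pos ∷_))) (∑±-mono (e ∘ (neg ∷_)))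

  ∑±-nonneg : ∀ {n} {g : Vec Sign n → Carrier} → (∀ x → 0# ≤ g x) → 0# ≤ ∑± g
  ∑±-nonneg {zero}  e = e []
  ∑±-nonneg {suc n} e = +-nonneg (∑±-nonneg (e ∘ (pos ∷_))) (∑±-nonneg (e ∘ (neg ∷_)))

  ∑±-*ˡ : ∀ {n} c (g : Vec Sign n → Carrier) → ∑± (λ x → c * g x) ≡ c * ∑± g
  ∑±-*ˡ {zero}  c g = refl
  ∑±-*ˡ {suc n} c g = trans
    (cong₂ _+_ (∑±-*ˡ c (g ∘ (pos ∷_))) (∑±-*ˡ c (g ∘ (neg ∷_))))
    (sym (distribˡ c _ _))

  ∑±-zero : ∀ {n} {g : Vec Sign n → Carrier} → (∀ x → g x ≡ 0#) → ∑± g ≡ 0#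
  ∑±-zero {zero}  e = e []
  ∑±-zero {suc n} e = trans
    (cong₂ _+_ (∑±-zero (e ∘ (pos ∷_))) (∑±-zero (e ∘ (neg ∷_))))
    (+-identityˡ 0#)

  Bern^-nonneg : ∀ {n p} → I01 p → (b : Vec Sign n) → 0# ≤ Bern^ p b
  Bern^-nonneg _           []        = 0≤1
  Bern^-nonneg i@(0≤p , _) (pos ∷ b) = *-nonneg 0≤p (Bern^-nonneg i b)
  Bern^-nonneg i@(_ , p≤1) (neg ∷ b) = *-nonneg (x≤y⇒0≤y-x p≤1) (Bern^-nonneg i b)

  Bern^-total : ∀ n p → ∑± {n} (Bern^ p) ≡ 1#
  Bern^-total zero    p = refl
  Bern^-total (suc n) p = begin
    ∑± {n} (λ b → p * Bern^ p b) + ∑± {n} (λ b → (1# - p) * Bern^ p b)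
      ≡⟨ cong₂ _+_ (∑±-*ˡ {n} p (Bern^ p)) (∑±-*ˡ {n} (1# - p) (Bern^ p)) ⟩
    p * ∑± {n} (Bern^ p) + (1# - p) * ∑± {n} (Bern^ p)
      ≡⟨ cong (λ t → p * t + (1# - p) * t) (Bern^-total n p) ⟩
    p * 1# + (1# - p) * 1#
      ≡⟨ cong₂ _+_ (*-identityʳ p) (*-identityʳ (1# - p)) ⟩
    p + (1# - p)
      ≡⟨ +-comm p (1# - p) ⟩
    (1# - p) + p
      ≡⟨ y-x+x≡y p 1# ⟩
    1# ∎
    where open ≡-Reasoning

  𝔼-I01 : ∀ {n} {m g : Vec Sign n → Carrier} → (∀ x → 0# ≤ m x) → ∑± m ≡ 1# →
          (∀ x → I01 (g x)) → I01 (𝔼 m g)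
  𝔼-I01 {m = m} {g} m≥0 m≡1 g∈ =
    ∑±-nonneg (λ x → *-nonneg (m≥0 x) (proj₁ (g∈ x))) ,
    subst (𝔼 m g ≤_) m≡1 (∑±-mono λ x →
      subst (m x * g x ≤_) (*-identityʳ (m x)) (*-monoʳ-≤ (m≥0 x) (proj₂ (g∈ x))))

  ⟦⟧-I01 : ∀ b → I01 ⟦ b ⟧
  ⟦⟧-I01 true  = 0≤1 , ≤-refl
  ⟦⟧-I01 false = ≤-refl , 0≤1

  λₛ-I01 : ∀ {k} (S : Subset (suc k)) D {p} → I01 p → I01 (λₛ S D p)
  λₛ-I01 {k} S D {p} p∈ = 𝔼-I01 (nonneg D) (total D) λ a →
    𝔼-I01 (Bern^-nonneg p∈) (Bern^-total k p) λ b → ⟦⟧-I01 (f S (a ⊙ b))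

  0∈I01 : I01 0#
  0∈I01 = ≤-refl , 0≤1

  1∈I01 : I01 1#
  1∈I01 = 0≤1 , ≤-refl

  ----------------------------------------------------------------------
  -- β, γ and α

  βₛ : ∀ {k} → Subset (suc k) → Δ k → Carrier
  βₛ S D = sup (λ x → ∃[ p ] I01 p × x ≡ λₛ S D p)
    (_ , 0# , 0∈I01 , refl)
    (1# , λ { _ (p , p∈ , refl) → proj₂ (λₛ-I01 S D p∈) })

  γₛ : ∀ {k} → Subset (suc k) → Δ k → Carrier
  γₛ S D = λₛ S D 1#

  -- γ_{S,k}(m).  The last argument says that m is the mean of some
  -- member of Δ, i.e. that the supremum is over a nonempty set; this
  -- holds exactly for m ∈ [-1,1].

  γₛₖ : ∀ {k} → Subset (suc (suc k)) → (m : Carrier) → ∃[ D ] μ {k} D ≡ m → Carrier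
  γₛₖ S m (D₀ , μ≡m) = sup (λ x → ∃[ D ] μ D ≡ m × x ≡ γₛ S D)
    (_ , D₀ , μ≡m , refl)
    (1# , λ { _ (D , _ , refl) → proj₂ (λₛ-I01 S D 1∈I01) })

  βₛ-nonneg : ∀ {k} (S : Subset (suc k)) D → 0# ≤ βₛ S D
  βₛ-nonneg S D = ≤-trans (proj₁ (λₛ-I01 S D 0∈I01))
    (proj₁ (sup-isSupremum _ _ _) _ (0# , 0∈I01 , refl))

  γₛ≤γₛₖ : ∀ {k} (S : Subset (suc (suc k))) (D : Δ (suc k)) → γₛ S D ≤ γₛₖ S (μ D) (D , refl)
  γₛ≤γₛₖ S D = proj₁ (sup-isSupremum _ _ _) _ (D , refl , refl)

  γₛ-nonneg : ∀ {k} (S : Subset (suc k)) D → 0# ≤ γₛ S D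
  γₛ-nonneg S D = proj₁ (λₛ-I01 S D 1∈I01)

  γₛₖ-nonneg : ∀ {k} (S : Subset (suc (suc k))) (D : Δ (suc k)) → 0# ≤ γₛₖ S (μ D) (D , refl)
  γₛₖ-nonneg S D = ≤-trans (γₛ-nonneg S D) (γₛ≤γₛₖ S D)

  -- Some γₛ S D is nonzero; equivalently, not all ratios in the infimum
  -- defining α are +∞, so that α is a real number.

  Satisfiable : ∀ {k} → Subset (suc k) → Set
  Satisfiable S = ∃[ D ] γₛ S D ≢ 0#

  α : ∀ {k} (S : Subset (suc (suc k))) → Satisfiable S → Carrier
  α {k} S (D₀ , γ≢0) = inf
    (λ r → Σ[ Dₙ ∈ Δ (suc k) ] Σ[ Dᵧ ∈ Δ (suc k) ]
             μ Dₙ ≡ μ Dᵧ × r ≡ ratio (βₛ S Dₙ) (γₛ S Dᵧ))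
    (let q , q≡ = ratio-finite γ≢0 in q , D₀ , D₀ , refl , q≡)
    (0# , λ { _ (Dₙ , Dᵧ , _ , refl) → ratio-nonneg (βₛ-nonneg S Dₙ) (γₛ-nonneg S Dᵧ) })

  -- The infimum over Dₙ of λₛ S Dₙ p / γ_{S,k}(μ Dₙ), for a fixed p.

  infAt : ∀ {k} (S : Subset (suc (suc k))) → Satisfiable S → ∀ p → I01 p → Carrier
  infAt {k} S (D₀ , γ≢0) p p∈ = inf
    (λ r → Σ[ Dₙ ∈ Δ (suc k) ] r ≡ ratio (λₛ S Dₙ p) (γₛₖ S (μ Dₙ) (Dₙ , refl)))
    (let q , q≡ = ratio-finite γₛₖ≢0 in q , D₀ , q≡)
    (0# , λ { _ (Dₙ , refl) → ratio-nonneg (proj₁ (λₛ-I01 S Dₙ p∈)) (γₛₖ-nonneg S Dₙ) })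
    where
    γₛₖ≢0 : γₛₖ S (μ D₀) (D₀ , refl) ≢ 0#
    γₛₖ≢0 e = γ≢0 (≤-antisym (subst (γₛ S D₀ ≤_) e (γₛ≤γₛₖ S D₀)) (γₛ-nonneg S D₀))

  ----------------------------------------------------------------------
  -- Thresholds are satisfiable: the point mass at (1,…,1) has γ = 1

  1-1≡0 : 1# - 1# ≡ 0#
  1-1≡0 = -‿inverseʳ 1#

  𝔼-Bern^-1 : ∀ {n} (g : Vec Sign n → Carrier) → 𝔼 (Bern^ 1#) g ≡ g (replicate n pos)
  𝔼-Bern^-1 {zero}  g = *-identityˡ (g [])
  𝔼-Bern^-1 {suc n} g = trans (cong₂ _+_
    (trans (∑±-cong λ b → cong (_* g (pos ∷ b)) (*-identityˡ (Bern^ 1# b)))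
           (𝔼-Bern^-1 (g ∘ (pos ∷_))))
    (∑±-zero λ b → trans
      (cong (_* g (neg ∷ b)) (trans (cong (_* Bern^ 1# b) 1-1≡0) (zeroˡ (Bern^ 1# b))))
      (zeroˡ (g (neg ∷ b)))))
    (+-identityʳ _)

  Bern^-1≡ : ∀ {n} (x : Vec Sign n) → Bern^ 1# x ≡ ⟦ does (ones x ℕ.≟ n) ⟧
  Bern^-1≡ []        = refl
  Bern^-1≡ (pos ∷ x) = trans (*-identityˡ (Bern^ 1# x)) (Bern^-1≡ x)
  Bern^-1≡ {suc n} (neg ∷ x) = trans
    (trans (cong (_* Bern^ 1# x) 1-1≡0) (zeroˡ (Bern^ 1# x)))
    (cong ⟦_⟧ (sym (dec-false (ones x ℕ.≟ suc n)
      (λ e → ℕ.<-irrefl e (s≤s (ones≤k x))))))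

  allOnes : ∀ k → Δ k
  allOnes k = record
    { mass      = Bern^ 1#
    ; nonneg    = Bern^-nonneg 1∈I01
    ; total     = Bern^-total k 1#
    ; symmetric = λ x y e → trans (Bern^-1≡ x)
        (trans (cong (λ s → ⟦ does (s ℕ.≟ k) ⟧) e) (sym (Bern^-1≡ y)))
    }

  ones-replicate : ∀ k → ones (replicate k pos ⊙ replicate k pos) ≡ k
  ones-replicate zero    = refl
  ones-replicate (suc k) = cong suc (ones-replicate k)

  T⇒⟦⟧≡1 : ∀ {b} → T b → ⟦ b ⟧ ≡ 1#
  T⇒⟦⟧≡1 {true} _ = refl

  threshold-satisfiable : ∀ {k i} → i ℕ.≤ k → Satisfiable {k} (from i)
  threshold-satisfiable {k} {i} i≤k = allOnes k , λ γ≡0 → 0≢1 (trans (sym γ≡0) γ≡1)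
    where
    𝟙 : Vec Sign k
    𝟙 = replicate k pos

    accepted : T (Th i (𝟙 ⊙ 𝟙))
    accepted = ℕ.≤⇒≤ᵇ (subst (i ℕ.≤_) (sym (ones-replicate k)) i≤k)

    γ≡1 : γₛ (from i) (allOnes k) ≡ 1#
    γ≡1 = begin
      γₛ (from i) (allOnes k)
        ≡⟨ 𝔼-Bern^-1 {k} (λ a → 𝔼 (Bern^ 1#) (λ b → ⟦ f (from i) (a ⊙ b) ⟧)) ⟩
      𝔼 (Bern^ 1#) (λ b → ⟦ f (from i) (𝟙 ⊙ b) ⟧)
        ≡⟨ 𝔼-Bern^-1 {k} (λ b → ⟦ f (from i) (𝟙 ⊙ b) ⟧) ⟩
      ⟦ f (from i) (𝟙 ⊙ 𝟙) ⟧
        ≡⟨ cong ⟦_⟧ (sym (Th≗f i (𝟙 ⊙ 𝟙))) ⟩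
      ⟦ Th i (𝟙 ⊙ 𝟙) ⟧
        ≡⟨ T⇒⟦⟧≡1 accepted ⟩
      1# ∎
      where open ≡-Reasoning

  ----------------------------------------------------------------------
  -- Max-CSP

  record Constraint (n k : ℕ) : Set where
    field
      signs    : Vec Sign k
      vars     : Vec (Fin n) k
      distinct : Unique vars

  open Constraint public

  record Instance (n k : ℕ) : Set where
    field
      m               : ℕ
      constraint      : Fin m → Constraint n k
      weight          : Fin m → Carrier
      weight-nonneg   : ∀ ℓ → 0# ≤ weight ℓ
      weight-positive : 0# < sum weight

    W : Carrier
    W = sum weight

  open Instance public

  valAt : ∀ {n k} → (Vec Sign k → Bool) → Instance n k → Vec Sign n → Carrier
  valAt g Ψ σ = divide
    (sum λ ℓ → let c = constraint Ψ ℓ in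
       weight Ψ ℓ * ⟦ g (signs c ⊙ Vec.map (lookup σ) (vars c)) ⟧)
    (W Ψ)
    (λ W≡0 → proj₂ (weight-positive Ψ) (sym W≡0))

  val : ∀ {n k} → (Vec Sign k → Bool) → Instance n k → Carrier
  val g Ψ = max± (valAt g Ψ)

  diff : ∀ {n k} → Instance n k → Fin n → Carrier
  diff Ψ v = sum λ ℓ → sum λ t → let c = constraint Ψ ℓ in
    if does (lookup (vars c) t Fin.≟ v) then ⟦ lookup (signs c) t ⟧± * weight Ψ ℓ else 0#

  ----------------------------------------------------------------------
  -- The randomized algorithm

  majority : ∀ {n k} → Instance n k → Vec Sign n
  majority Ψ = tabulate λ v → if does (0# ≤? diff Ψ v) then pos else neg

  -- The random choices of the algorithm form a vector in {-1,1}ⁿ, where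
  -- 1 means "keep" and -1 means "flip".

  output : ∀ {n k} → Instance n k → Vec Sign n → Vec Sign n
  output Ψ choices = majority Ψ ⊙ choices

  expectedValue : ∀ {n k} → (Vec Sign k → Bool) → Carrier → Instance n k → Carrier
  expectedValue g p Ψ = 𝔼 (Bern^ p) (λ choices → valAt g Ψ (output Ψ choices))

------------------------------------------------------------------------
-- The arithmetic, order and CSP notions of the ambient copy of ℝ, found by
-- instance resolution

module Notation where
  open CompleteOrderedField {{...}} public using (Carrier; _*_; _≤_)
  open MaxCSP public

{-# OPTIONS --safe #-}

-- Draw a constraint ℓ with probability w_ℓ / W and symmetrise the vector
-- b(ℓ) ⊙ σ|_{j(ℓ)}; this gives a distribution empirical Ψ σ in Δ.  Flipping
-- the entries of σ independently is Bern(p)ᵏ noise on each constraint, because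
-- its variables are distinct, so λ of this distribution is the expected value
-- of the noisy σ.  Its mean is proportional to ∑_v diff_v σ_v, which the
-- majority assignment maximises.  For thresholds, a distribution can be moved
-- to any larger mean by mixing it with the point mass at (1,…,1), and this does
-- not decrease γ.  So γ_{S,k} at the mean of the majority distribution is at
-- least the value of an optimal assignment.

module Submission where

open import Algebra.Bundles using (CommutativeRing)
import Algebra.Properties.CommutativeMonoid.Sum as CommutativeMonoidSum
import Algebra.Properties.CommutativeSemigroup as CommutativeSemigroupProperties
import Algebra.Properties.Ring as RingProperties
import Algebra.Properties.Semiring.Sum as SemiringSum
import Algebra.Solver.Ring.NaturalCoefficients.Default as Solver
open import Data.Bool.Base using (if_then_else_)
open import Data.Fin.Base using (Fin; zero; suc)
import Data.Fin.Properties as Fin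
open import Data.Fin.Subset using (Subset)
open import Data.Nat.Base as ℕ using (ℕ; zero; suc; z≤n; s≤s)
import Data.Nat.Properties as ℕ
open import Data.Product.Base using (∃-syntax; _×_; _,_; proj₁; proj₂)
open import Data.Sign.Base as Sign using (Sign) renaming (+ to pos; - to neg)
import Data.Sign.Properties as Sign
open import Data.Sum.Base using (inj₁; inj₂)
open import Data.Vec.Base as Vec using (Vec; []; _∷_; lookup; replicate; _[_]≔_)
import Data.Vec.Properties as Vec
open import Data.Vec.Relation.Unary.All using (All; []; _∷_)
open import Data.Vec.Relation.Unary.AllPairs.Core using ([]; _∷_)
open import Data.Vec.Relation.Unary.Unique.Propositional using (Unique)
open import Function.Base using (_∘_)
open import Relation.Binary.PropositionalEquality
open import Relation.Nullary using (yes; no; does)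
open import Relation.Nullary.Decidable using (dec-true; dec-false)
open import Relation.Nullary.Negation using (contradiction)
open import Defs

-- Rearrangements of sign vectors

infix 4 _↭_

-- A swap is a generator only for unequal neighbours, since swapping equal ones is covered by
-- `↭-refl`. An invariant of rearrangement is then checked generator by generator.
data _↭_ : ∀ {n} → Vec Sign n → Vec Sign n → Set where
  ↭-refl  : ∀ {n} {x : Vec Sign n} → x ↭ x
  ↭-prep  : ∀ {n} s {x y : Vec Sign n} → x ↭ y → s ∷ x ↭ s ∷ y
  ↭-swap  : ∀ {n} (x : Vec Sign n) → neg ∷ pos ∷ x ↭ pos ∷ neg ∷ x
  ↭-sym   : ∀ {n} {x y : Vec Sign n} → x ↭ y → y ↭ x
  ↭-trans : ∀ {n} {x y z : Vec Sign n} → x ↭ y → y ↭ z → x ↭ z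

sorted : ∀ n → ℕ → Vec Sign n
sorted zero    _       = []
sorted (suc n) zero    = neg ∷ sorted n zero
sorted (suc n) (suc s) = pos ∷ sorted n s

-- The leading `neg` moves past the block of `pos` one swap at a time. The bound matters: for larger
-- `s` the right side would consist of `pos` only.
neg∷sorted : ∀ {n s} → s ℕ.≤ n → neg ∷ sorted n s ↭ sorted (suc n) s
neg∷sorted z≤n     = ↭-refl
neg∷sorted (s≤s p) = ↭-trans (↭-swap _) (↭-prep pos (neg∷sorted p))

↭-sorted : ∀ {n} (x : Vec Sign n) → x ↭ sorted n (ones x)
↭-sorted []        = ↭-refl
↭-sorted (pos ∷ x) = ↭-prep pos (↭-sorted x)
↭-sorted (neg ∷ x) = ↭-trans (↭-prep neg (↭-sorted x)) (neg∷sorted (ones≤k x))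

-- Both vectors rearrange to the same sorted vector, which depends only on the number of ones.
ones≡⇒↭ : ∀ {n} {x y : Vec Sign n} → ones x ≡ ones y → x ↭ y
ones≡⇒↭ {n} {x} {y} e = ↭-trans
  (subst (λ s → x ↭ sorted n s) e (↭-sorted x)) (↭-sym (↭-sorted y))

-- Products and restrictions of assignments

⊙-assoc : ∀ {n} (x y z : Vec Sign n) → (x ⊙ y) ⊙ z ≡ x ⊙ (y ⊙ z)
⊙-assoc = Vec.zipWith-assoc Sign.*-assoc

⊙-ones : ∀ {n} (x : Vec Sign n) → x ⊙ replicate n pos ≡ x
⊙-ones = Vec.zipWith-identityʳ Sign.*-identityʳ

map-lookup-⊙ : ∀ {n k} (σ τ : Vec Sign n) (js : Vec (Fin n) k) →
  Vec.map (lookup (σ ⊙ τ)) js ≡ Vec.map (lookup σ) js ⊙ Vec.map (lookup τ) js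
map-lookup-⊙ σ τ []       = refl
map-lookup-⊙ σ τ (j ∷ js) = cong₂ _∷_ (Vec.lookup-zipWith Sign._*_ j σ τ) (map-lookup-⊙ σ τ js)

map-lookup-update : ∀ {n k} (c : Vec Sign n) (j : Fin n) s (js : Vec (Fin n) k) →
  All (j ≢_) js → Vec.map (lookup (c [ j ]≔ s)) js ≡ Vec.map (lookup c) js
map-lookup-update c j s []        []          = refl
map-lookup-update c j s (j′ ∷ js) (j≢j′ ∷ ps) =
  cong₂ _∷_ (Vec.lookup∘update′ (j≢j′ ∘ sym) c s) (map-lookup-update c j s js ps)

module _ {{ℝ : CompleteOrderedField}} where
  open CompleteOrderedField ℝ
  open MaxCSP {{ℝ}}
  open CommutativeRing commutativeRing
    using (semiring; commutativeSemiring; +-commutativeSemigroup; *-commutativeSemigroup)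
  open RingProperties ring using (-‿involutive; -1*x≈-x; x∙y⁻¹≈ε⇒x≈y)
  open CommutativeMonoidSum +-commutativeMonoid using (sum-cong-≗; ∑-comm)
  open SemiringSum semiring using (*-distribˡ-sum; *-distribʳ-sum)
  open Solver commutativeSemiring using (solve; _:=_; _:+_; _:*_)
  open CommutativeSemigroupProperties +-commutativeSemigroup
    using () renaming (interchange to +-interchange; x∙yz≈y∙xz to x+[y+z]≡y+[x+z])
  open CommutativeSemigroupProperties *-commutativeSemigroup
    using ()
    renaming (x∙yz≈y∙xz to x[yz]≡y[xz]; xy∙z≈xz∙y to [xy]z≡[xz]y; xy∙z≈y∙xz to [xy]z≡y[xz])
  open ≡-Reasoning

  -- Order facts and finite sums

  *-monoˡ-≤ : ∀ {z x y} → 0# ≤ z → x ≤ y → x * z ≤ y * z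
  *-monoˡ-≤ {z} {x} {y} 0≤z x≤y = subst₂ _≤_ (*-comm z x) (*-comm z y) (*-monoʳ-≤ 0≤z x≤y)

  +-cancelʳ-≤ : ∀ z {x y} → x + z ≤ y + z → x ≤ y
  +-cancelʳ-≤ z {x} {y} p = subst₂ _≤_ (x+z-z≡x x) (x+z-z≡x y) (+-monoˡ-≤ (- z) p)
    where
    x+z-z≡x : ∀ x → x + z + - z ≡ x
    x+z-z≡x x = trans (+-assoc x z (- z)) (trans (cong (x +_) (-‿inverseʳ z)) (+-identityʳ x))

  -- The shape of the final estimate. Both equations can be matched with `refl` because all the
  -- quantities are variables here.
  scale-≤ : ∀ {a b u v x y} → 0# ≤ a → a ≡ b → u ≤ v → b * v ≤ x → x ≡ y → a * u ≤ y
  scale-≤ 0≤a refl u≤v bv≤x refl = ≤-trans (*-monoʳ-≤ 0≤a u≤v) bv≤x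

  x≤0⇒x≤-x : ∀ {x} → x ≤ 0# → x ≤ - x
  x≤0⇒x≤-x p = ≤-trans p (x≤0⇒0≤-x p)

  0≤x⇒-x≤x : ∀ {x} → 0# ≤ x → - x ≤ x
  0≤x⇒-x≤x {x} p = ≤-trans
    (0≤y-x⇒x≤y (subst (0# ≤_) (sym (trans (+-identityˡ (- - x)) (-‿involutive x))) p)) p

  sum-mono : ∀ {n} {g h : Fin n → Carrier} → (∀ t → g t ≤ h t) → sum g ≤ sum h
  sum-mono {zero}  e = ≤-refl
  sum-mono {suc n} e = +-mono-≤ (e zero) (sum-mono (e ∘ suc))

  sum-nonneg : ∀ {n} {g : Fin n → Carrier} → (∀ t → 0# ≤ g t) → 0# ≤ sum g
  sum-nonneg {zero}  e = ≤-refl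
  sum-nonneg {suc n} e = +-nonneg (e zero) (sum-nonneg (e ∘ suc))

  -- Comparing `suc n` equal summands replaces dividing by `suc n`. If `y ≤ x`, the last `n` copies
  -- of `y` are bounded by copies of `x`, which then cancel.
  sum-const-cancel-≤ : ∀ n {x y} → sum {suc n} (λ _ → x) ≤ sum {suc n} (λ _ → y) → x ≤ y
  sum-const-cancel-≤ n {x} {y} p with ≤-total x y
  ... | inj₁ x≤y = x≤y
  ... | inj₂ y≤x = +-cancelʳ-≤ _ (≤-trans p
    (+-mono-≤ ≤-refl (sum-mono {n} (λ _ → y≤x))))

  sum-select : ∀ {n} c (j : Fin n) (x : Fin n → Carrier) →
    sum (λ v → (if does (j Fin.≟ v) then c else 0#) * x v) ≡ c * x j
  sum-select {suc n} c zero    x = trans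
    (cong (c * x zero +_) (trans (sym (*-distribˡ-sum 0# (x ∘ suc))) (zeroˡ _)))
    (+-identityʳ _)
  sum-select {suc n} c (suc j) x = trans
    (cong₂ _+_ (zeroˡ (x zero)) (sum-select c j (x ∘ suc)))
    (+-identityˡ _)

  -- Sums, maxima and expectations over sign vectors

  ∑±-+ : ∀ {n} (g h : Vec Sign n → Carrier) → ∑± (λ x → g x + h x) ≡ ∑± g + ∑± h
  ∑±-+ {zero}  g h = refl
  ∑±-+ {suc n} g h = trans
    (cong₂ _+_ (∑±-+ (g ∘ (pos ∷_)) (h ∘ (pos ∷_))) (∑±-+ (g ∘ (neg ∷_)) (h ∘ (neg ∷_))))
    (+-interchange _ _ _ _)

  ∑±-sum : ∀ {n m} (g : Fin m → Vec Sign n → Carrier) →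
    ∑± (λ x → sum (λ t → g t x)) ≡ sum (λ t → ∑± (g t))
  ∑±-sum {n} {zero}  g = ∑±-zero {n} {g = λ _ → 0#} (λ _ → refl)
  ∑±-sum {n} {suc m} g = trans (∑±-+ (g zero) _) (cong (∑± (g zero) +_) (∑±-sum (g ∘ suc)))

  ∑±-single : ∀ {n} (g : Vec Sign n → Carrier) → (∀ x → 0# ≤ g x) → ∀ y → g y ≤ ∑± g
  ∑±-single g g≥0 []        = ≤-refl
  ∑±-single g g≥0 (pos ∷ y) = subst (_≤ ∑± g) (+-identityʳ _)
    (+-mono-≤ (∑±-single _ (g≥0 ∘ (pos ∷_)) y) (∑±-nonneg (g≥0 ∘ (neg ∷_))))
  ∑±-single g g≥0 (neg ∷ y) = subst (_≤ ∑± g) (+-identityˡ _)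
    (+-mono-≤ (∑±-nonneg (g≥0 ∘ (pos ∷_))) (∑±-single _ (g≥0 ∘ (neg ∷_)) y))

  max±-attained : ∀ {n} (g : Vec Sign n → Carrier) → ∃[ σ ] max± g ≡ g σ
  max±-attained {zero}  g = [] , refl
  max±-attained {suc n} g
    -- Abstracting the comparison as well makes `_⊔_` in the goal reduce to one of its arguments.
    with max±-attained (g ∘ (pos ∷_)) | max±-attained (g ∘ (neg ∷_))
       | max± (g ∘ (pos ∷_)) ≤? max± (g ∘ (neg ∷_))
  ... | _ | τ , e | yes _ = neg ∷ τ , e
  ... | σ , e | _ | no _  = pos ∷ σ , e

  𝔼-cong : ∀ {n} (m : Vec Sign n → Carrier) {g h : Vec Sign n → Carrier} →
    g ≗ h → 𝔼 m g ≡ 𝔼 m h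
  𝔼-cong m e = ∑±-cong (λ x → cong (m x *_) (e x))

  𝔼-mono : ∀ {n} {m g h : Vec Sign n → Carrier} → (∀ x → 0# ≤ m x) →
    (∀ x → g x ≤ h x) → 𝔼 m g ≤ 𝔼 m h
  𝔼-mono m≥0 e = ∑±-mono (λ x → *-monoʳ-≤ (m≥0 x) (e x))

  𝔼-const : ∀ {n} (m : Vec Sign n → Carrier) c → ∑± m ≡ 1# → 𝔼 m (λ _ → c) ≡ c
  𝔼-const m c e = begin
    ∑± (λ x → m x * c)  ≡⟨ ∑±-cong (λ x → *-comm (m x) c) ⟩
    ∑± (λ x → c * m x)  ≡⟨ ∑±-*ˡ c m ⟩
    c * ∑± m            ≡⟨ cong (c *_) e ⟩
    c * 1#              ≡⟨ *-identityʳ c ⟩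
    c                   ∎

  𝔼-sum : ∀ {n l} (m : Vec Sign n → Carrier) (g : Fin l → Vec Sign n → Carrier) →
    𝔼 m (λ x → sum (λ t → g t x)) ≡ sum (λ t → 𝔼 m (g t))
  𝔼-sum m g = trans (∑±-cong (λ x → *-distribˡ-sum (m x) (λ t → g t x))) (∑±-sum (λ t x → m x * g t x))

  𝔼-*ˡ : ∀ {n} (m : Vec Sign n → Carrier) c (g : Vec Sign n → Carrier) →
    𝔼 m (λ x → c * g x) ≡ c * 𝔼 m g
  𝔼-*ˡ m c g = trans
    (∑±-cong (λ x → x[yz]≡y[xz] (m x) c (g x)))
    (∑±-*ˡ c (λ x → m x * g x))

  -- Conditioning and marginals of Bernoulli vectors

  𝔼-Bern^-suc : ∀ {n} p (g : Vec Sign (suc n) → Carrier) →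
    𝔼 (Bern^ p) g ≡ p * 𝔼 (Bern^ p) (g ∘ (pos ∷_)) + (1# - p) * 𝔼 (Bern^ p) (g ∘ (neg ∷_))
  𝔼-Bern^-suc p g = cong₂ _+_ (pull p (g ∘ (pos ∷_))) (pull (1# - p) (g ∘ (neg ∷_)))
    where
    pull : ∀ {n} c (h : Vec Sign n → Carrier) → ∑± (λ b → c * Bern^ p b * h b) ≡ c * 𝔼 (Bern^ p) h
    pull c h = trans (∑±-cong (λ b → *-assoc c (Bern^ p b) (h b))) (∑±-*ˡ c (λ b → Bern^ p b * h b))

  -- Conditioning on coordinate `j`: by independence, the other coordinates keep their distribution
  -- once the value at `j` is overwritten.
  𝔼-Bern^-update : ∀ {n} p (j : Fin n) (g : Vec Sign n → Carrier) →
    𝔼 (Bern^ p) g ≡ p * 𝔼 (Bern^ p) (λ c → g (c [ j ]≔ pos))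
                  + (1# - p) * 𝔼 (Bern^ p) (λ c → g (c [ j ]≔ neg))
  𝔼-Bern^-update {suc n} p zero g = trans (𝔼-Bern^-suc p g)
    (cong₂ (λ a b → p * a + (1# - p) * b) (forget pos) (forget neg))
    where
    -- After overwriting, the drawn first coordinate is irrelevant, and its two probabilities add up
    -- to 1.
    forget : ∀ s → 𝔼 {n} (Bern^ p) (g ∘ (s ∷_)) ≡ 𝔼 {suc n} (Bern^ p) (λ c → g (c [ zero ]≔ s))
    forget s = sym (begin
      𝔼 {suc n} (Bern^ p) (λ c → g (c [ zero ]≔ s)) ≡⟨ 𝔼-Bern^-suc p (λ c → g (c [ zero ]≔ s)) ⟩
      p * e + (1# - p) * e                           ≡⟨ distribʳ e p (1# - p) ⟨
      (p + (1# - p)) * e                             ≡⟨ cong (_* e) (trans (+-comm p _) (y-x+x≡y p 1#)) ⟩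
      1# * e                                         ≡⟨ *-identityˡ e ⟩
      e                                              ∎)
      where e = 𝔼 {n} (Bern^ p) (g ∘ (s ∷_))
  𝔼-Bern^-update {suc n} p (suc j) g = begin
    𝔼 (Bern^ p) g
      ≡⟨ 𝔼-Bern^-suc p g ⟩
    p * 𝔼 (Bern^ p) (g ∘ (pos ∷_)) + q * 𝔼 (Bern^ p) (g ∘ (neg ∷_))
      ≡⟨ cong₂ (λ a b → p * a + q * b)
           (𝔼-Bern^-update p j (g ∘ (pos ∷_))) (𝔼-Bern^-update p j (g ∘ (neg ∷_))) ⟩
    p * (p * e pos pos + q * e pos neg) + q * (p * e neg pos + q * e neg neg)
      -- Conditioning on the first coordinate and on `j` commute.
      ≡⟨ solve 6 (λ p q a b c d → p :* (p :* a :+ q :* b) :+ q :* (p :* c :+ q :* d)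
                               := p :* (p :* a :+ q :* c) :+ q :* (p :* b :+ q :* d))
           refl p q (e pos pos) (e pos neg) (e neg pos) (e neg neg) ⟩
    p * (p * e pos pos + q * e neg pos) + q * (p * e pos neg + q * e neg neg)
      ≡⟨ cong₂ (λ a b → p * a + q * b)
           (𝔼-Bern^-suc p (λ c → g (c [ suc j ]≔ pos)))
           (𝔼-Bern^-suc p (λ c → g (c [ suc j ]≔ neg))) ⟨
    p * 𝔼 (Bern^ p) (λ c → g (c [ suc j ]≔ pos)) + q * 𝔼 (Bern^ p) (λ c → g (c [ suc j ]≔ neg)) ∎
    where
    q = 1# - p
    e : Sign → Sign → Carrier
    e s t = 𝔼 {n} (Bern^ p) (λ c → g (s ∷ (c [ j ]≔ t)))

  -- The marginal of a product distribution on distinct coordinates is again a product. Distinctness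
  -- ensures that fixing coordinate `j` does not disturb the entries read at `js`.
  𝔼-Bern^-restrict : ∀ {n k} p (js : Vec (Fin n) k) → Unique js → (g : Vec Sign k → Carrier) →
    𝔼 (Bern^ p) (λ c → g (Vec.map (lookup c) js)) ≡ 𝔼 (Bern^ p) g
  𝔼-Bern^-restrict {n} p [] [] g =
    trans (𝔼-const {n} (Bern^ p) (g []) (Bern^-total n p)) (sym (*-identityˡ (g [])))
  𝔼-Bern^-restrict {n} p (j ∷ js) (j∉js ∷ js!) g = begin
    𝔼 (Bern^ p) (λ c → g (Vec.map (lookup c) (j ∷ js)))
      ≡⟨ 𝔼-Bern^-update p j _ ⟩
    p * 𝔼 (Bern^ p) (λ c → g (Vec.map (lookup (c [ j ]≔ pos)) (j ∷ js))) +
    (1# - p) * 𝔼 (Bern^ p) (λ c → g (Vec.map (lookup (c [ j ]≔ neg)) (j ∷ js)))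
      ≡⟨ cong₂ (λ a b → p * a + (1# - p) * b) (fixed pos) (fixed neg) ⟩
    p * 𝔼 (Bern^ p) (g ∘ (pos ∷_)) + (1# - p) * 𝔼 (Bern^ p) (g ∘ (neg ∷_))
      ≡⟨ 𝔼-Bern^-suc p g ⟨
    𝔼 (Bern^ p) g ∎
    where
    fixed : ∀ s → 𝔼 (Bern^ p) (λ c → g (Vec.map (lookup (c [ j ]≔ s)) (j ∷ js)))
                ≡ 𝔼 (Bern^ p) (g ∘ (s ∷_))
    fixed s = trans
      (𝔼-cong (Bern^ p) (λ c → cong g
        (cong₂ _∷_ (Vec.lookup∘update j c s) (map-lookup-update c j s js j∉js))))
      (𝔼-Bern^-restrict p js js! (g ∘ (s ∷_)))

  -- Symmetry of the noisy acceptance probability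

  Symmetric : ∀ {n} → (Vec Sign n → Carrier) → Set
  Symmetric g = ∀ x y → ones x ≡ ones y → g x ≡ g y

  -- The predicate enters as a function `G` of the number of ones, so that a leading `pos` in the
  -- product just shifts `G` to `G ∘ suc`.
  noise : ∀ {n} → Carrier → (ℕ → Carrier) → Vec Sign n → Carrier
  noise p G a = 𝔼 (Bern^ p) (λ b → G (ones (a ⊙ b)))

  noise-pos : ∀ {n} p G (x : Vec Sign n) →
    noise p G (pos ∷ x) ≡ p * noise p (G ∘ suc) x + (1# - p) * noise p G x
  noise-pos p G x = 𝔼-Bern^-suc p (λ b → G (ones ((pos ∷ x) ⊙ b)))

  noise-neg : ∀ {n} p G (x : Vec Sign n) →
    noise p G (neg ∷ x) ≡ p * noise p G x + (1# - p) * noise p (G ∘ suc) x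
  noise-neg p G x = 𝔼-Bern^-suc p (λ b → G (ones ((neg ∷ x) ⊙ b)))

  -- `G` stays universally quantified because the induction needs both `G` and `G ∘ suc`.
  noise-↭ : ∀ {n} p {x y : Vec Sign n} → x ↭ y → ∀ G → noise p G x ≡ noise p G y
  noise-↭ p ↭-refl G = refl
  noise-↭ p (↭-sym e) G = sym (noise-↭ p e G)
  noise-↭ p (↭-trans d e) G = trans (noise-↭ p d G) (noise-↭ p e G)
  noise-↭ p (↭-prep pos {x} {y} e) G = trans (noise-pos p G x) (trans
    (cong₂ (λ a b → p * a + (1# - p) * b) (noise-↭ p e (G ∘ suc)) (noise-↭ p e G))
    (sym (noise-pos p G y)))
  noise-↭ p (↭-prep neg {x} {y} e) G = trans (noise-neg p G x) (trans
    (cong₂ (λ a b → p * a + (1# - p) * b) (noise-↭ p e G) (noise-↭ p e (G ∘ suc)))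
    (sym (noise-neg p G y)))
  noise-↭ p (↭-swap x) G = begin
    noise p G (neg ∷ pos ∷ x)
      ≡⟨ noise-neg p G (pos ∷ x) ⟩
    p * noise p G (pos ∷ x) + q * noise p (G ∘ suc) (pos ∷ x)
      ≡⟨ cong₂ (λ a b → p * a + q * b) (noise-pos p G x) (noise-pos p (G ∘ suc) x) ⟩
    p * (p * N₁ + q * N₀) + q * (p * N₂ + q * N₁)
      ≡⟨ solve 5 (λ p q a b c → p :* (p :* b :+ q :* a) :+ q :* (p :* c :+ q :* b)
                             := p :* (p :* b :+ q :* c) :+ q :* (p :* a :+ q :* b))
           refl p q N₀ N₁ N₂ ⟩
    p * (p * N₁ + q * N₂) + q * (p * N₀ + q * N₁)
      ≡⟨ cong₂ (λ a b → p * a + q * b) (noise-neg p (G ∘ suc) x) (noise-neg p G x) ⟨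
    p * noise p (G ∘ suc) (neg ∷ x) + q * noise p G (neg ∷ x)
      ≡⟨ noise-pos p G (neg ∷ x) ⟨
    noise p G (pos ∷ neg ∷ x) ∎
    where
    -- The index is the number of ones among the two leading coordinates after noise. In either
    -- order `N₁` has weight `p * p + q * q`, while `N₀` and `N₂` have weight `p * q` each.
    q N₀ N₁ N₂ : Carrier
    q  = 1# - p
    N₀ = noise p G x
    N₁ = noise p (G ∘ suc) x
    N₂ = noise p (λ s → G (suc (suc s))) x

  acceptance : ∀ {n} → Carrier → ℕ → Vec Sign n → Carrier
  acceptance p i a = 𝔼 (Bern^ p) (λ b → ⟦ Th i (a ⊙ b) ⟧)

  acceptance-symmetric : ∀ {n} p i → Symmetric {n} (acceptance p i)
  acceptance-symmetric p i x y e = noise-↭ p (ones≡⇒↭ {x = x} {y} e) (λ s → ⟦ i ℕ.≤ᵇ s ⟧)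

  λₛ-threshold : ∀ {k} i (D : Δ k) p → λₛ (from i) D p ≡ 𝔼 (mass D) (acceptance p i)
  λₛ-threshold i D p = 𝔼-cong (mass D) (λ a → 𝔼-cong (Bern^ p) (λ b →
    cong ⟦_⟧ (sym (Th≗f i (a ⊙ b)))))

  -- The mean as an average over coordinates

  total± : ∀ {n} → Vec Sign n → Carrier
  total± x = sum (λ t → ⟦ lookup x t ⟧±)

  total±-↭ : ∀ {n} {x y : Vec Sign n} → x ↭ y → total± x ≡ total± y
  total±-↭ ↭-refl        = refl
  total±-↭ (↭-prep s e)  = cong (⟦ s ⟧± +_) (total±-↭ e)
  total±-↭ (↭-swap x)    = x+[y+z]≡y+[x+z] _ _ _
  total±-↭ (↭-sym e)     = sym (total±-↭ e)
  total±-↭ (↭-trans d e) = trans (total±-↭ d) (total±-↭ e)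

  -- Symmetry of `m` exchanges the first two coordinates. With the first one then fixed to either
  -- sign, `m` is still symmetric and the induction continues on the tail.
  ∑±-exchange : ∀ {n} (m : Vec Sign (suc n) → Carrier) → Symmetric m → ∀ t →
    ∑± (λ x → m x * ⟦ Vec.head x ⟧±) ≡ ∑± (λ x → m x * ⟦ lookup x t ⟧±)
  ∑±-exchange {n} m m-sym zero = refl
  ∑±-exchange {suc n} m m-sym (suc t) = begin
    (c pos pos pos + c pos neg pos) + (c neg pos neg + c neg neg neg)
      ≡⟨ +-interchange _ _ _ _ ⟩
    (c pos pos pos + c neg pos neg) + (c pos neg pos + c neg neg neg)
      ≡⟨ cong₂ (λ a b → c pos pos pos + a + (b + c neg neg neg)) swap-neg swap-pos ⟩
    (c pos pos pos + c pos neg neg) + (c neg pos pos + c neg neg neg)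
      ≡⟨ cong₂ _+_
           (∑±-exchange (m ∘ (pos ∷_)) (λ x y e → m-sym (pos ∷ x) (pos ∷ y) (cong suc e)) t)
           (∑±-exchange (m ∘ (neg ∷_)) (λ x y e → m-sym (neg ∷ x) (neg ∷ y) e) t) ⟩
    ∑± (λ x → m x * ⟦ lookup x (suc t) ⟧±) ∎
    where
    c : Sign → Sign → Sign → Carrier
    c s s′ r = ∑± (λ x → m (s ∷ s′ ∷ x) * ⟦ r ⟧±)

    swap-neg : c neg pos neg ≡ c pos neg neg
    swap-neg = ∑±-cong (λ x → cong (_* ⟦ neg ⟧±) (m-sym (neg ∷ pos ∷ x) (pos ∷ neg ∷ x) refl))

    swap-pos : c pos neg pos ≡ c neg pos pos
    swap-pos = ∑±-cong (λ x → cong (_* ⟦ pos ⟧±) (m-sym (pos ∷ neg ∷ x) (neg ∷ pos ∷ x) refl))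

  sum-μ : ∀ {k} (D : Δ (suc k)) → sum {suc k} (λ _ → μ D) ≡ 𝔼 (mass D) total±
  sum-μ D = trans (sum-cong-≗ (∑±-exchange (mass D) (symmetric D)))
    (sym (𝔼-sum (mass D) (λ t x → ⟦ lookup x t ⟧±)))

  μ≤1 : ∀ {k} (D : Δ (suc k)) → μ D ≤ 1#
  μ≤1 D = subst (μ D ≤_) (𝔼-const (mass D) 1# (total D))
    (𝔼-mono (nonneg D) (λ x → ⟦⟧±≤1 (Vec.head x)))
    where
    ⟦⟧±≤1 : ∀ s → ⟦ s ⟧± ≤ 1#
    ⟦⟧±≤1 pos = ≤-refl
    ⟦⟧±≤1 neg = 0≤x⇒-x≤x 0≤1

  -- Mixtures and uniform distributions on levels

  mixture : ∀ {k l} (w : Fin l → Carrier) → (∀ ℓ → 0# ≤ w ℓ) → sum w ≡ 1# →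
    (Fin l → Δ k) → Δ k
  mixture w w≥0 w≡1 D = record
    { mass      = λ x → sum (λ ℓ → w ℓ * mass (D ℓ) x)
    ; nonneg    = λ x → sum-nonneg (λ ℓ → *-nonneg (w≥0 ℓ) (nonneg (D ℓ) x))
    ; total     = trans (∑±-sum (λ ℓ x → w ℓ * mass (D ℓ) x))
        (trans (sum-cong-≗ {x = λ ℓ → ∑± (λ x → w ℓ * mass (D ℓ) x)} {w} (λ ℓ →
          trans (∑±-*ˡ (w ℓ) (mass (D ℓ)))
            (trans (cong (w ℓ *_) (total (D ℓ))) (*-identityʳ (w ℓ))))) w≡1)
    ; symmetric = λ x y e → sum-cong-≗ (λ ℓ → cong (w ℓ *_) (symmetric (D ℓ) x y e))
    }

  𝔼-mixture : ∀ {k l} (w : Fin l → Carrier) w≥0 w≡1 (D : Fin l → Δ k) g →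
    𝔼 (mass (mixture w w≥0 w≡1 D)) g ≡ sum (λ ℓ → w ℓ * 𝔼 (mass (D ℓ)) g)
  𝔼-mixture w w≥0 w≡1 D g = begin
    ∑± (λ x → sum (λ ℓ → w ℓ * mass (D ℓ) x) * g x)
      ≡⟨ ∑±-cong (λ x → trans (*-distribʳ-sum (g x) (λ ℓ → w ℓ * mass (D ℓ) x))
           (sum-cong-≗ {x = λ ℓ → w ℓ * mass (D ℓ) x * g x} (λ ℓ → *-assoc (w ℓ) (mass (D ℓ) x) (g x)))) ⟩
    ∑± (λ x → sum (λ ℓ → w ℓ * (mass (D ℓ) x * g x)))
      ≡⟨ ∑±-sum (λ ℓ x → w ℓ * (mass (D ℓ) x * g x)) ⟩
    sum (λ ℓ → ∑± (λ x → w ℓ * (mass (D ℓ) x * g x)))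
      ≡⟨ sum-cong-≗ (λ ℓ → ∑±-*ˡ (w ℓ) (λ x → mass (D ℓ) x * g x)) ⟩
    sum (λ ℓ → w ℓ * 𝔼 (mass (D ℓ)) g) ∎

  level : ∀ {n} → Vec Sign n → Vec Sign n → Carrier
  level y x = ⟦ does (ones x ℕ.≟ ones y) ⟧

  level-nonneg : ∀ {n} (y x : Vec Sign n) → 0# ≤ level y x
  level-nonneg y x = proj₁ (⟦⟧-I01 (does (ones x ℕ.≟ ones y)))

  1≤∑±-level : ∀ {n} (y : Vec Sign n) → 1# ≤ ∑± (level y)
  1≤∑±-level y = subst (_≤ ∑± (level y))
    (cong ⟦_⟧ (dec-true (ones y ℕ.≟ ones y) refl))
    (∑±-single (level y) (level-nonneg y) y)

  ∑±-level≢0 : ∀ {n} (y : Vec Sign n) → ∑± (level y) ≢ 0#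
  ∑±-level≢0 y e = 0≢1 (≤-antisym 0≤1 (subst (1# ≤_) e (1≤∑±-level y)))

  -- The symmetrisation of the point mass at `y`. Its normaliser is left as a sum of indicators,
  -- nonzero because `y` itself contributes 1, so no binomial coefficient is computed.
  uniform : ∀ {n} → Vec Sign n → Δ n
  uniform y = record
    { mass      = λ x → divide (level y x) N N≢0
    ; nonneg    = λ x → divide-nonneg N≢0 (level-nonneg y x) (∑±-nonneg (level-nonneg y))
    ; total     = begin
        ∑± (λ x → level y x * N⁻¹)  ≡⟨ ∑±-cong (λ x → *-comm (level y x) N⁻¹) ⟩
        ∑± (λ x → N⁻¹ * level y x)  ≡⟨ ∑±-*ˡ N⁻¹ (level y) ⟩
        N⁻¹ * N                     ≡⟨ *-comm N⁻¹ N ⟩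
        N * N⁻¹                     ≡⟨ proj₂ (inverse N N≢0) ⟩
        1#                          ∎
    ; symmetric = λ x x′ e → cong (λ s → ⟦ does (s ℕ.≟ ones y) ⟧ * N⁻¹) e
    }
    where
    N   = ∑± (level y)
    N≢0 = ∑±-level≢0 y
    N⁻¹ = proj₁ (inverse N N≢0)

  -- On the support, `g` takes the constant value `g y`. Thus symmetrising a pattern is invisible to
  -- symmetric functions.
  𝔼-uniform : ∀ {n} (y : Vec Sign n) (g : Vec Sign n → Carrier) → Symmetric g →
    𝔼 (mass (uniform y)) g ≡ g y
  𝔼-uniform y g g-sym = trans (∑±-cong on-level) (𝔼-const (mass (uniform y)) (g y) (total (uniform y)))
    where
    on-level : ∀ x → mass (uniform y) x * g x ≡ mass (uniform y) x * g y
    on-level x with ones x ℕ.≟ ones y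
    ... | yes e = cong (_ *_) (g-sym x y e)
    ... | no ≢y = trans (vanishes (g x)) (sym (vanishes (g y)))
      where
      vanishes : ∀ c → mass (uniform y) x * c ≡ 0#
      vanishes c = trans
        (cong (_* c) (trans
          (cong (λ d → ⟦ d ⟧ * proj₁ (inverse (∑± (level y)) (∑±-level≢0 y)))
            (dec-false (ones x ℕ.≟ ones y) ≢y))
          (zeroˡ _)))
        (zeroˡ c)

  ⟦⟧±-* : ∀ s t → ⟦ s Sign.* t ⟧± ≡ ⟦ s ⟧± * ⟦ t ⟧±
  ⟦⟧±-* pos t   = sym (*-identityˡ _)
  ⟦⟧±-* neg pos = sym (*-identityʳ _)
  ⟦⟧±-* neg neg = sym (trans (-1*x≈-x (- 1#)) (-‿involutive 1#))

  -- The empirical distribution of an instance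

  module _ {n k} (Ψ : Instance n k) where

    W≢0 : W Ψ ≢ 0#
    W≢0 e = proj₂ (weight-positive Ψ) (sym e)

    W⁻¹ : Carrier
    W⁻¹ = proj₁ (inverse (W Ψ) W≢0)

    0≤W⁻¹ : 0# ≤ W⁻¹
    0≤W⁻¹ = inverse-nonneg W≢0 (proj₁ (weight-positive Ψ))

    share : Fin (m Ψ) → Carrier
    share ℓ = weight Ψ ℓ * W⁻¹

    share-nonneg : ∀ ℓ → 0# ≤ share ℓ
    share-nonneg ℓ = *-nonneg (weight-nonneg Ψ ℓ) 0≤W⁻¹

    share-total : sum share ≡ 1#
    share-total = trans (sym (*-distribʳ-sum W⁻¹ (weight Ψ))) (proj₂ (inverse (W Ψ) W≢0))

    pattern-at : Vec Sign n → Fin (m Ψ) → Vec Sign k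
    pattern-at σ ℓ = signs (constraint Ψ ℓ) ⊙ Vec.map (lookup σ) (vars (constraint Ψ ℓ))

    pattern-⊙ : ∀ σ τ ℓ → pattern-at (σ ⊙ τ) ℓ
                        ≡ pattern-at σ ℓ ⊙ Vec.map (lookup τ) (vars (constraint Ψ ℓ))
    pattern-⊙ σ τ ℓ = trans
      (cong (signs (constraint Ψ ℓ) ⊙_) (map-lookup-⊙ σ τ (vars (constraint Ψ ℓ))))
      (sym (⊙-assoc (signs (constraint Ψ ℓ)) _ _))

    sum-share : ∀ (g : Fin (m Ψ) → Carrier) →
      sum (λ ℓ → weight Ψ ℓ * g ℓ) * W⁻¹ ≡ sum (λ ℓ → share ℓ * g ℓ)
    sum-share g = trans (*-distribʳ-sum W⁻¹ (λ ℓ → weight Ψ ℓ * g ℓ))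
      (sum-cong-≗ {x = λ ℓ → weight Ψ ℓ * g ℓ * W⁻¹} (λ ℓ → [xy]z≡[xz]y (weight Ψ ℓ) (g ℓ) W⁻¹))

    empirical : Vec Sign n → Δ k
    empirical σ = mixture share share-nonneg share-total (uniform ∘ pattern-at σ)

    𝔼-empirical : ∀ σ (g : Vec Sign k → Carrier) → Symmetric g →
      𝔼 (mass (empirical σ)) g ≡ sum (λ ℓ → share ℓ * g (pattern-at σ ℓ))
    𝔼-empirical σ g g-sym = trans
      (𝔼-mixture share share-nonneg share-total (uniform ∘ pattern-at σ) g)
      (sum-cong-≗ (λ ℓ → cong (share ℓ *_) (𝔼-uniform (pattern-at σ ℓ) g g-sym)))

    -- Acceptance under noise is symmetric, so the left side is an average over constraints. The
    -- flips seen by a single constraint are independent by `𝔼-Bern^-restrict`, and linearity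
    -- collects the constraints into one expectation.
    λₛ-empirical : ∀ i σ p →
      λₛ (from i) (empirical σ) p ≡ 𝔼 (Bern^ p) (λ c → valAt (Th i) Ψ (σ ⊙ c))
    λₛ-empirical i σ p = begin
      λₛ (from i) (empirical σ) p
        ≡⟨ λₛ-threshold i (empirical σ) p ⟩
      𝔼 (mass (empirical σ)) (acceptance p i)
        ≡⟨ 𝔼-empirical σ (acceptance p i) (acceptance-symmetric p i) ⟩
      sum (λ ℓ → share ℓ * acceptance p i (pattern-at σ ℓ))
        ≡⟨ sum-cong-≗ (λ ℓ → cong (share ℓ *_) (noisy-constraint ℓ)) ⟨
      sum (λ ℓ → share ℓ * 𝔼 (Bern^ p) (λ c → ⟦ Th i (pattern-at (σ ⊙ c) ℓ) ⟧))
        ≡⟨ sum-cong-≗ (λ ℓ → 𝔼-*ˡ {n} (Bern^ p) (share ℓ) _) ⟨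
      sum (λ ℓ → 𝔼 (Bern^ p) (λ c → share ℓ * ⟦ Th i (pattern-at (σ ⊙ c) ℓ) ⟧))
        ≡⟨ 𝔼-sum {n} (Bern^ p) (λ ℓ c → share ℓ * ⟦ Th i (pattern-at (σ ⊙ c) ℓ) ⟧) ⟨
      𝔼 (Bern^ p) (λ c → sum (λ ℓ → share ℓ * ⟦ Th i (pattern-at (σ ⊙ c) ℓ) ⟧))
        ≡⟨ 𝔼-cong {n} (Bern^ p) (λ c → sum-share (λ ℓ → ⟦ Th i (pattern-at (σ ⊙ c) ℓ) ⟧)) ⟨
      𝔼 (Bern^ p) (λ c → valAt (Th i) Ψ (σ ⊙ c)) ∎
      where
      noisy-constraint : ∀ ℓ → 𝔼 (Bern^ p) (λ c → ⟦ Th i (pattern-at (σ ⊙ c) ℓ) ⟧)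
                             ≡ acceptance p i (pattern-at σ ℓ)
      noisy-constraint ℓ = trans
        (𝔼-cong {n} (Bern^ p) (λ c → cong (⟦_⟧ ∘ Th i) (pattern-⊙ σ c ℓ)))
        (𝔼-Bern^-restrict p (vars (constraint Ψ ℓ)) (distinct (constraint Ψ ℓ))
          (λ b → ⟦ Th i (pattern-at σ ℓ ⊙ b) ⟧))

    -- At `p = 1` no sign is flipped.
    γₛ-empirical : ∀ i σ → γₛ (from i) (empirical σ) ≡ valAt (Th i) Ψ σ
    γₛ-empirical i σ = begin
      γₛ (from i) (empirical σ)                         ≡⟨ λₛ-empirical i σ 1# ⟩
      𝔼 (Bern^ 1#) (λ c → valAt (Th i) Ψ (σ ⊙ c))       ≡⟨ 𝔼-Bern^-1 (λ c → valAt (Th i) Ψ (σ ⊙ c)) ⟩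
      valAt (Th i) Ψ (σ ⊙ replicate n pos)              ≡⟨ cong (valAt (Th i) Ψ) (⊙-ones σ) ⟩
      valAt (Th i) Ψ σ                                  ∎

    -- Correlation with `diff` and optimality of the majority assignment

    correlation : Vec Sign n → Carrier
    correlation σ = sum (λ v → diff Ψ v * ⟦ lookup σ v ⟧±)

    -- Double counting: the occurrences of literals are grouped by variable on one side and by
    -- constraint on the other.
    correlation≡ : ∀ σ → correlation σ ≡ sum (λ ℓ → weight Ψ ℓ * total± (pattern-at σ ℓ))
    correlation≡ σ = begin
      sum (λ v → sum (λ ℓ → sum (λ t → entry ℓ t v)) * s v)
        ≡⟨ sum-cong-≗ (λ v → trans (*-distribʳ-sum (s v) (λ ℓ → sum (λ t → entry ℓ t v)))
             (sum-cong-≗ (λ ℓ → *-distribʳ-sum (s v) (λ t → entry ℓ t v)))) ⟩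
      sum (λ v → sum (λ ℓ → sum (λ t → entry ℓ t v * s v)))
        ≡⟨ ∑-comm (λ v ℓ → sum (λ t → entry ℓ t v * s v)) ⟩
      sum (λ ℓ → sum (λ v → sum (λ t → entry ℓ t v * s v)))
        ≡⟨ sum-cong-≗ (λ ℓ → ∑-comm (λ v t → entry ℓ t v * s v)) ⟩
      sum (λ ℓ → sum (λ t → sum (λ v → entry ℓ t v * s v)))
        ≡⟨ sum-cong-≗ (λ ℓ → sum-cong-≗ (λ t → trans
             (sum-select _ (lookup (vars (constraint Ψ ℓ)) t) s) (literal ℓ t))) ⟩
      sum (λ ℓ → sum (λ t → weight Ψ ℓ * ⟦ lookup (pattern-at σ ℓ) t ⟧±))
        ≡⟨ sum-cong-≗ (λ ℓ → *-distribˡ-sum (weight Ψ ℓ) (λ t → ⟦ lookup (pattern-at σ ℓ) t ⟧±)) ⟨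
      sum (λ ℓ → weight Ψ ℓ * total± (pattern-at σ ℓ)) ∎
      where
      s : Fin n → Carrier
      s v = ⟦ lookup σ v ⟧±

      entry : Fin (m Ψ) → Fin k → Fin n → Carrier
      entry ℓ t v = if does (lookup (vars (constraint Ψ ℓ)) t Fin.≟ v)
        then ⟦ lookup (signs (constraint Ψ ℓ)) t ⟧± * weight Ψ ℓ else 0#

      literal : ∀ ℓ t → ⟦ lookup (signs (constraint Ψ ℓ)) t ⟧± * weight Ψ ℓ
                          * s (lookup (vars (constraint Ψ ℓ)) t)
                        ≡ weight Ψ ℓ * ⟦ lookup (pattern-at σ ℓ) t ⟧±
      literal ℓ t = trans ([xy]z≡y[xz] _ _ _) (cong (weight Ψ ℓ *_) (sym (begin
        ⟦ lookup (pattern-at σ ℓ) t ⟧±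
          ≡⟨ cong ⟦_⟧± (Vec.lookup-zipWith Sign._*_ t b _) ⟩
        ⟦ lookup b t Sign.* lookup (Vec.map (lookup σ) js) t ⟧±
          ≡⟨ cong (λ r → ⟦ lookup b t Sign.* r ⟧±) (Vec.lookup-map t (lookup σ) js) ⟩
        ⟦ lookup b t Sign.* lookup σ (lookup js t) ⟧±
          ≡⟨ ⟦⟧±-* (lookup b t) _ ⟩
        ⟦ lookup b t ⟧± * s (lookup js t) ∎)))
        where
        b  = signs (constraint Ψ ℓ)
        js = vars (constraint Ψ ℓ)

    -- The variables decouple: each summand is at most the absolute value of `diff Ψ v`, which the
    -- majority sign attains.
    correlation≤majority : ∀ σ → correlation σ ≤ correlation (majority Ψ)
    correlation≤majority σ = sum-mono (λ v → subst (λ r → diff Ψ v * ⟦ lookup σ v ⟧± ≤ diff Ψ v * ⟦ r ⟧±)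
      (sym (Vec.lookup∘tabulate _ v)) (best (diff Ψ v) (lookup σ v)))
      where
      x*-1≡-x : ∀ x → x * - 1# ≡ - x
      x*-1≡-x x = trans (*-comm x (- 1#)) (-1*x≈-x x)

      best : ∀ d r → d * ⟦ r ⟧± ≤ d * ⟦ if does (0# ≤? d) then pos else neg ⟧±
      best d r with 0# ≤? d
      best d pos | yes 0≤d = ≤-refl
      best d neg | yes 0≤d = subst₂ _≤_ (sym (x*-1≡-x d)) (sym (*-identityʳ d)) (0≤x⇒-x≤x 0≤d)
      best d neg | no 0≰d = ≤-refl
      best d pos | no 0≰d with ≤-total 0# d
      ... | inj₁ 0≤d = contradiction 0≤d 0≰d
      ... | inj₂ d≤0 = subst₂ _≤_ (sym (*-identityʳ d)) (sym (x*-1≡-x d)) (x≤0⇒x≤-x d≤0)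

  sum-μ-empirical : ∀ {n k} (Ψ : Instance n (suc k)) σ →
    sum {suc k} (λ _ → μ (empirical Ψ σ)) ≡ correlation Ψ σ * W⁻¹ Ψ
  sum-μ-empirical {k = k} Ψ σ = begin
    sum {suc k} (λ _ → μ (empirical Ψ σ))
      ≡⟨ sum-μ (empirical Ψ σ) ⟩
    𝔼 (mass (empirical Ψ σ)) total±
      ≡⟨ 𝔼-empirical Ψ σ total± (λ x y e → total±-↭ (ones≡⇒↭ {x = x} {y} e)) ⟩
    sum (λ ℓ → share Ψ ℓ * total± (pattern-at Ψ σ ℓ))
      ≡⟨ sum-share Ψ _ ⟨
    sum (λ ℓ → weight Ψ ℓ * total± (pattern-at Ψ σ ℓ)) * W⁻¹ Ψ
      ≡⟨ cong (_* W⁻¹ Ψ) (correlation≡ Ψ σ) ⟨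
    correlation Ψ σ * W⁻¹ Ψ ∎

  μ-empirical≤majority : ∀ {n k} (Ψ : Instance n (suc k)) σ →
    μ (empirical Ψ σ) ≤ μ (empirical Ψ (majority Ψ))
  μ-empirical≤majority {k = k} Ψ σ = sum-const-cancel-≤ k (subst₂ _≤_
    (sym (sum-μ-empirical Ψ σ)) (sym (sum-μ-empirical Ψ (majority Ψ)))
    (*-monoˡ-≤ (0≤W⁻¹ Ψ) (correlation≤majority Ψ σ)))

  -- Raising the mean of a distribution

  γₛ-allOnes : ∀ {k i} → i ℕ.≤ k → γₛ (from i) (allOnes k) ≡ 1#
  γₛ-allOnes {k} {i} i≤k = begin
    γₛ (from i) (allOnes k)            ≡⟨ λₛ-threshold i (allOnes k) 1# ⟩
    𝔼 {k} (Bern^ 1#) (acceptance 1# i) ≡⟨ 𝔼-Bern^-1 {k} (acceptance 1# i) ⟩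
    acceptance 1# i 𝟙                  ≡⟨ 𝔼-Bern^-1 {k} (λ b → ⟦ Th i (𝟙 ⊙ b) ⟧) ⟩
    ⟦ Th i (𝟙 ⊙ 𝟙) ⟧                   ≡⟨ T⇒⟦⟧≡1 (ℕ.≤⇒≤ᵇ (subst (i ℕ.≤_) (sym (ones-replicate k)) i≤k)) ⟩
    1#                                 ∎
    where
    𝟙 : Vec Sign k
    𝟙 = replicate k pos

  module _ {k i} (i≤k : i ℕ.≤ suc k) (D : Δ (suc k)) {b} (μ≤b : μ D ≤ b) (b≤1 : b ≤ 1#) where

    -- The weights (1-b)/(1-μ D) and (b-μ D)/(1-μ D) of D and of the point mass
    -- at (1,…,1) give the mixture the mean b.
    raise-mean : ∃[ D′ ] μ D′ ≡ b × γₛ {suc k} (from i) D ≤ γₛ (from i) D′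
    raise-mean with 1# - μ D ≟ 0#
    -- Mean 1 leaves no room: `b` is 1 as well, and `D` itself serves.
    ... | yes 1-μ≡0 = D , ≤-antisym μ≤b (≤-trans b≤1 (≤-reflexive (x∙y⁻¹≈ε⇒x≈y _ _ 1-μ≡0))) , ≤-refl
    ... | no 1-μ≢0 = D′ , μ-D′ , γ≤γ′
      where
      a r u t : Carrier
      a = μ D
      r = proj₁ (inverse (1# - a) 1-μ≢0)
      u = (1# - b) * r
      t = (b - a) * r

      0≤r : 0# ≤ r
      0≤r = inverse-nonneg 1-μ≢0 (x≤y⇒0≤y-x (μ≤1 D))

      w : Fin 2 → Carrier
      w zero       = u
      w (suc zero) = t

      parts : Fin 2 → Δ (suc k)
      parts zero       = D
      parts (suc zero) = allOnes (suc k)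

      w≥0 : ∀ ℓ → 0# ≤ w ℓ
      w≥0 zero       = *-nonneg (x≤y⇒0≤y-x b≤1) 0≤r
      w≥0 (suc zero) = *-nonneg (x≤y⇒0≤y-x μ≤b) 0≤r

      u+t≡1 : u + t ≡ 1#
      u+t≡1 = begin
        (1# - b) * r + (b - a) * r  ≡⟨ distribʳ r (1# - b) (b - a) ⟨
        (1# - b + (b - a)) * r      ≡⟨ cong (_* r) (sym (+-assoc (1# - b) b (- a))) ⟩
        (1# - b + b - a) * r        ≡⟨ cong (λ z → (z - a) * r) (y-x+x≡y b 1#) ⟩
        (1# - a) * r                ≡⟨ proj₂ (inverse (1# - a) 1-μ≢0) ⟩
        1#                          ∎

      w≡1 : sum w ≡ 1#
      w≡1 = trans (cong (u +_) (+-identityʳ t)) u+t≡1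

      D′ : Δ (suc k)
      D′ = mixture w w≥0 w≡1 parts

      𝔼-D′ : ∀ g → 𝔼 (mass D′) g ≡ u * 𝔼 (mass D) g + t * 𝔼 (mass (allOnes (suc k))) g
      𝔼-D′ g = trans (𝔼-mixture w w≥0 w≡1 parts g) (cong (u * 𝔼 (mass D) g +_)
        (+-identityʳ (t * 𝔼 (mass (allOnes (suc k))) g)))

      t-scaled : t * (1# - a) ≡ b - a
      t-scaled = trans (*-assoc (b - a) r (1# - a))
        (trans (cong ((b - a) *_) (trans (*-comm r (1# - a)) (proj₂ (inverse (1# - a) 1-μ≢0))))
          (*-identityʳ (b - a)))

      first accepted : Vec Sign (suc k) → Carrier
      first x    = ⟦ Vec.head x ⟧±
      accepted x = 𝔼 (Bern^ 1#) (λ y → ⟦ f (from i) (x ⊙ y) ⟧)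

      μ-D′ : μ D′ ≡ b
      μ-D′ = begin
        μ D′                                 ≡⟨ 𝔼-D′ first ⟩
        u * a + t * μ (allOnes (suc k))      ≡⟨ cong (λ z → u * a + t * z) (𝔼-Bern^-1 {suc k} first) ⟩
        -- Splitting 1 as `(1# - a) + a` separates the original mean `a` from the increase
        -- `t * (1# - a)`.
        u * a + t * 1#                       ≡⟨ cong (λ z → u * a + t * z) (y-x+x≡y a 1#) ⟨
        u * a + t * (1# - a + a)             ≡⟨ solve 4 (λ u t a c → u :* a :+ t :* (c :+ a)
                                                  := t :* c :+ (u :+ t) :* a) refl u t a (1# - a) ⟩
        t * (1# - a) + (u + t) * a           ≡⟨ cong₂ (λ y z → y + z * a) t-scaled u+t≡1 ⟩
        b - a + 1# * a                       ≡⟨ cong (b - a +_) (*-identityˡ a) ⟩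
        b - a + a                            ≡⟨ y-x+x≡y a b ⟩
        b                                    ∎

      γ : Δ (suc k) → Carrier
      γ = γₛ (from i)

      -- The share `t` of `γ D` is replaced by the same share of 1, the largest value that γ can
      -- take.
      γ≤γ′ : γ D ≤ γ D′
      γ≤γ′ = subst₂ _≤_
        (trans (sym (distribʳ (γ D) u t)) (trans (cong (_* γ D) u+t≡1) (*-identityˡ (γ D))))
        (trans (cong (λ z → u * γ D + t * z) (sym (γₛ-allOnes i≤k))) (sym (𝔼-D′ accepted)))
        (+-mono-≤ (≤-refl {u * γ D}) (*-monoʳ-≤ (w≥0 (suc zero)) (proj₂ (λₛ-I01 (from i) D 1∈I01))))

  -- Raised to the mean of `D′`, the distribution `D` yields a competitor in the supremum there.
  γₛ≤γₛₖ-mono : ∀ {k i} → i ℕ.≤ suc k → (D D′ : Δ (suc k)) → μ D ≤ μ D′ →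
    γₛ (from i) D ≤ γₛₖ (from i) (μ D′) (D′ , refl)
  γₛ≤γₛₖ-mono i≤k D D′ μ≤μ′ with raise-mean i≤k D μ≤μ′ (μ≤1 D′)
  ... | D″ , μ≡ , γ≤ = ≤-trans γ≤ (proj₁ (sup-isSupremum _ _ _) _ (D″ , μ≡ , refl))

  -- From the infimum to the approximation guarantee

  ≤∞-ratio : ∀ {l x y} → fin l ≤∞ ratio x y → 0# ≤ x → 0# ≤ y → l * y ≤ x
  ≤∞-ratio {l} {x} {y} l≤ 0≤x 0≤y with y ≟ 0#
  -- The ratio +∞ carries no information, but the left side is then 0 and `x` is nonnegative.
  ... | yes y≡0 = subst (_≤ x) (sym (trans (cong (l *_) y≡0) (zeroʳ l))) 0≤x
  ... | no y≢0  = subst (l * y ≤_)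
    (trans (*-assoc x y⁻¹ y)
      (trans (cong (x *_) (trans (*-comm y⁻¹ y) (proj₂ (inverse y y≢0)))) (*-identityʳ x)))
    (*-monoˡ-≤ 0≤y l≤)
    where y⁻¹ = proj₁ (inverse y y≢0)

  -- Allows the bound on `val` to be multiplied by α.
  α-nonneg : ∀ {k} (S : Subset (suc (suc k))) (sat : Satisfiable S) → 0# ≤ α S sat
  α-nonneg S sat = inf-greatest _ _ _ 0#
    λ { _ (Dₙ , Dᵧ , _ , refl) → ratio-nonneg (βₛ-nonneg S Dₙ) (γₛ-nonneg S Dᵧ) }

  infAt*γₛₖ≤λₛ : ∀ {k} (S : Subset (suc (suc k))) (sat : Satisfiable S) p p∈ (D : Δ (suc k)) →
    infAt S sat p p∈ * γₛₖ S (μ D) (D , refl) ≤ λₛ S D p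
  infAt*γₛₖ≤λₛ S sat p p∈ D = ≤∞-ratio
    (inf-lower (λ r → ∃[ Dₙ ] r ≡ ratio (λₛ S Dₙ p) (γₛₖ S (μ Dₙ) (Dₙ , refl))) _ _ _ (D , refl))
    (proj₁ (λₛ-I01 S D p∈)) (γₛₖ-nonneg S D)

  -- An optimal `σ` has value γ of its empirical distribution, whose mean is at most that of the
  -- majority distribution.
  val≤γₛₖ : ∀ {k i} → i ℕ.≤ suc k → ∀ {n} (Ψ : Instance n (suc k)) →
    let D = empirical Ψ (majority Ψ) in val (Th i) Ψ ≤ γₛₖ (from i) (μ D) (D , refl)
  val≤γₛₖ {i = i} i≤k Ψ with max±-attained (valAt (Th i) Ψ)
  ... | σ , val≡ = ≤-trans (≤-reflexive (trans val≡ (sym (γₛ-empirical Ψ i σ))))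
    (γₛ≤γₛₖ-mono i≤k (empirical Ψ σ) (empirical Ψ (majority Ψ)) (μ-empirical≤majority Ψ σ))

  α*val≤expectedValue : ∀ k i (i≤k : i ℕ.≤ suc k) p p∈ →
    α (from i) (threshold-satisfiable i≤k) ≡ infAt (from i) (threshold-satisfiable i≤k) p p∈ →
    ∀ n (Ψ : Instance n (suc k)) →
    α (from i) (threshold-satisfiable i≤k) * val (Th i) Ψ ≤ expectedValue (Th i) p Ψ
  α*val≤expectedValue k i i≤k p p∈ α≡infAt n Ψ = scale-≤
    (α-nonneg (from i) sat) α≡infAt (val≤γₛₖ i≤k Ψ)
    (infAt*γₛₖ≤λₛ (from i) sat p p∈ (empirical Ψ (majority Ψ)))
    (λₛ-empirical Ψ i (majority Ψ) p)
    where sat = threshold-satisfiable i≤k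

open Notation

theorem7p7 : {{ℝ : CompleteOrderedField}} (k i : ℕ) (1≤i : 1 ℕ.≤ i) (i≤k : i ℕ.≤ suc k)
    (p* : Carrier) (p*∈[0,1] : I01 p*) →
    α (from i) (threshold-satisfiable i≤k) ≡ infAt (from i) (threshold-satisfiable i≤k) p* p*∈[0,1] →
    (n : ℕ) (Ψ : Instance n (suc k)) →
    α (from i) (threshold-satisfiable i≤k) * val (Th i) Ψ ≤ expectedValue (Th i) p* Ψ
theorem7p7 k i 1≤i i≤k p* p*∈[0,1] = α*val≤expectedValue k i i≤k p* p*∈[0,1]
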